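{- Let $\mathcal{L}_\to$ be a sublanguage of $\mathcal{L}=\{\wedge,\vee,\to,\neg,0,1\}$ containing $\to$ and $\Phi$ a Sahlqvist quasiequation in $\mathcal{L}_\to$. If an $\mathcal{L}_\to$-subreduct $\boldsymbol{A}$ of a Heyting algebra validates $\mathsf{A}(\Phi)$, then the Heyting algebra $\mathsf{Up}(\boldsymbol{A}_\ast)$ validates $\mathsf{A}(\Phi)$.
   Context: Sahlqvist quasiequations over $\mathcal{L}$: an occurrence of a variable is positive (negative) if the number of negations and antecedents of implications in whose scope it lies is even (odd); a formula is positive (negative) if all its occurrences are. Sahlqvist antecedent: built from variables, negative formulas and $0,1$ using $\wedge,\vee$ only. Sahlqvist implication: positive, or $\neg\varphi$ with $\varphi$ a Sahlqvist antecedent, or $\varphi\to\psi$ with $\varphi$ a Sahlqvist antecedent, $\psi$ positive. $\Phi=(\varphi_1\wedge y\le z\ \&\cdots\&\ \varphi_m\wedge y\le z\Longrightarrow y\le z)$ with $y,z$ distinct variables not in the $\varphi_i$, each $\varphi_i$ built from Sahlqvist implications by $\wedge,\vee$; $\Phi$ is in $\mathcal{L}_\to$ if the $\varphi_i$ are $\mathcal{L}_\to$-formulas. An $\mathcal{L}_\to$-subreduct of a Heyting algebra is a subalgebra of its $\mathcal{L}_\to$-reduct; there $x\to x$ is constant with value $1$ and a formula $\varphi$ is valid if $\varphi\approx1$ holds. An implicative filter of $\boldsymbol{A}$ contains $1$ and $b$ whenever it contains $a$ and $a\to b$; $\boldsymbol{A}_\ast$ is the poset under inclusion of meet irreducible implicative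 filters (proper and not an intersection of two implicative filters different from it). $\mathsf{Up}(\mathbb{X})$ is the Heyting algebra of upsets of a poset $\mathbb{X}$ ($\cap,\cup$, $U\to V=X\setminus{\downarrow}(U\setminus V)$, $\emptyset$, $X$). Definition of $\mathsf{A}(\Phi)$: let ${\sim_p}(x_1,\dots,x_p)=\{x_1\to(\cdots(x_p\to0)\cdots)\}$, $(x_1..x_p)\Rightarrow_{pt}(y_1..y_t)=\{x_1\to(\cdots(x_p\to y_j)\cdots): j\le t\}$, $(x_1..x_p)\curlyvee_{pt}(y_1..y_t)=\{x_i\vee y_j\}$, $\top(x)$ a fixed intuitionistic theorem in variable $x$ (e.g. $x\to x$). For $\varphi(x_1,\dots,x_n)$, $k\in\mathbb{Z}^+$: $\boldsymbol{x_j}^k=\{x_j^1..x_j^k\}$, $\boldsymbol1^k=\{\top(x_1^1)\}$, $\boldsymbol0^k=\{x_1^1\}\cup{\sim_1}(x_1^1)$, $(\boldsymbol{\psi\wedge\chi})^k=\boldsymbol\psi^k\cup\boldsymbol\chi^k$, and with $\boldsymbol\psi^k=\{\psi_1..\psi_p\}$, $\boldsymbol\chi^k=\{\chi_1..\chi_t\}$: $(\boldsymbol{\neg\psi})^k={\sim_p}(\psi_1..\psi_p)$, $(\boldsymbol{\psi\to\chi})^k=(\psi_1..\psi_p)\Rightarrow_{pt}(\chi_1..\chi_t)$, $(\boldsymbol{\psi\vee\chi})^k=(\psi_1..\psi_p)\curlyvee_{pt}(\chi_1..\chi_t)$. For finite $\Gamma=\{\gamma_1..\gamma_p\}$, $\Gamma\to\varphi$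 is $\{\gamma_1\to(\cdots(\gamma_p\to\varphi)\cdots)\}$. $\mathsf{A}(\Phi)=\bigcup_{k}\big(((\boldsymbol{\varphi_1}^k\to y)\cup\cdots\cup(\boldsymbol{\varphi_m}^k\to y))\to y\big)$, $y$ a variable not in the $\boldsymbol{\varphi_i}^k$. -}

module Defs where

open import Level using (Level; _⊔_; Lift) renaming (suc to lsuc)
open import Data.Bool using (Bool; T)
open import Data.Nat using (ℕ; zero; suc)
open import Data.Product using (Σ; _×_; _,_; proj₁; ∃)
open import Data.Sum using (_⊎_)
open import Data.Empty renaming (⊥ to Empty)
open import Data.Unit renaming (⊤ to Unit)
open import Data.Maybe using (Maybe; just; nothing)
open import Data.List using (List; []; _∷_; _++_; map; foldr; concatMap)
open import Data.List.NonEmpty using (List⁺; toList)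
open import Data.List.Relation.Unary.All using (All)
open import Relation.Nullary using (¬_)
open import Relation.Binary.PropositionalEquality using (_≡_; _≢_)
open import Relation.Binary.Structures using (IsPreorder)
open import Relation.Binary.Lattice.Bundles using (HeytingAlgebra)

infixr 5 _⇒_
infixr 6 _∨̇_
infixr 7 _∧̇_

data Fm (V : Set) : Set where
  var  : V → Fm V
  _∧̇_  : Fm V → Fm V → Fm V
  _∨̇_  : Fm V → Fm V → Fm V
  _⇒_  : Fm V → Fm V → Fm V
  ¬̇_   : Fm V → Fm V
  𝟘 𝟙  : Fm V

data Occurs {V : Set} (v : V) : Fm V → Set where
  here : Occurs v (var v)
  ∧ˡ : ∀ {φ ψ} → Occurs v φ → Occurs v (φ ∧̇ ψ)
  ∧ʳ : ∀ {φ ψ} → Occurs v ψ → Occurs v (φ ∧̇ ψ)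
  ∨ˡ : ∀ {φ ψ} → Occurs v φ → Occurs v (φ ∨̇ ψ)
  ∨ʳ : ∀ {φ ψ} → Occurs v ψ → Occurs v (φ ∨̇ ψ)
  ⇒ˡ : ∀ {φ ψ} → Occurs v φ → Occurs v (φ ⇒ ψ)
  ⇒ʳ : ∀ {φ ψ} → Occurs v ψ → Occurs v (φ ⇒ ψ)
  ¬ᵒ : ∀ {φ} → Occurs v φ → Occurs v (¬̇ φ)

-- Sublanguages of L containing →  (→ is always present; the other
-- connectives are present according to the flags)

record Lang : Set where
  field
    has∧ has∨ has¬ has0 has1 : Bool
open Lang public

InL : Lang → {V : Set} → Fm V → Set
InL L (var x)  = Unit
InL L (φ ∧̇ ψ)  = T (has∧ L) × InL L φ × InL L ψ
InL L (φ ∨̇ ψ)  = T (has∨ L) × InL L φ × InL L ψ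
InL L (φ ⇒ ψ)  = InL L φ × InL L ψ
InL L (¬̇ φ)    = T (has¬ L) × InL L φ
InL L 𝟘        = T (has0 L)
InL L 𝟙        = T (has1 L)

mutual
  Pos : {V : Set} → Fm V → Set
  Pos (var x) = Unit
  Pos (φ ∧̇ ψ) = Pos φ × Pos ψ
  Pos (φ ∨̇ ψ) = Pos φ × Pos ψ
  Pos (φ ⇒ ψ) = Neg φ × Pos ψ
  Pos (¬̇ φ)   = Neg φ
  Pos 𝟘       = Unit
  Pos 𝟙       = Unit

  Neg : {V : Set} → Fm V → Set
  Neg (var x) = Empty
  Neg (φ ∧̇ ψ) = Neg φ × Neg ψ
  Neg (φ ∨̇ ψ) = Neg φ × Neg ψ
  Neg (φ ⇒ ψ) = Pos φ × Neg ψ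
  Neg (¬̇ φ)   = Pos φ
  Neg 𝟘       = Unit
  Neg 𝟙       = Unit

data SAnt {V : Set} : Fm V → Set where
  sa-var : ∀ x → SAnt (var x)
  sa-neg : ∀ {φ} → Neg φ → SAnt φ
  sa-0   : SAnt 𝟘
  sa-1   : SAnt 𝟙
  sa-∧   : ∀ {φ ψ} → SAnt φ → SAnt ψ → SAnt (φ ∧̇ ψ)
  sa-∨   : ∀ {φ ψ} → SAnt φ → SAnt ψ → SAnt (φ ∨̇ ψ)

data SImp {V : Set} : Fm V → Set where
  si-pos : ∀ {φ} → Pos φ → SImp φ
  si-¬   : ∀ {φ} → SAnt φ → SImp (¬̇ φ)
  si-⇒   : ∀ {φ ψ} → SAnt φ → Pos ψ → SImp (φ ⇒ ψ)

data SBody {V : Set} : Fm V → Set where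
  sb-imp : ∀ {φ} → SImp φ → SBody φ
  sb-∧   : ∀ {φ ψ} → SBody φ → SBody ψ → SBody (φ ∧̇ ψ)
  sb-∨   : ∀ {φ ψ} → SBody φ → SBody ψ → SBody (φ ∨̇ ψ)

-- Variables are x₁, x₂, x₃, … , encoded as var 0, var 1, var 2, …
-- A Sahlqvist quasiequation in L→:
--   φ₁ ∧ y ≤ z & ⋯ & φₘ ∧ y ≤ z ⟹ y ≤ z
record SahlqvistQE (L : Lang) : Set where
  field
    φs      : List⁺ (Fm ℕ)
    y z     : ℕ
    y≢z     : y ≢ z
    y∉      : All (λ φ → ¬ Occurs y φ) (toList φs)
    z∉      : All (λ φ → ¬ Occurs z φ) (toList φs)
    sahl    : All SBody (toList φs)
    inL     : All (InL L) (toList φs)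
open SahlqvistQE public

-- variables of the translated formulas: just (j , i) is x_{j+1}^i,
-- nothing is the fresh variable y
TV : Set
TV = Maybe (ℕ × ℕ)

x[_,_] : ℕ → ℕ → Fm TV
x[ j , i ] = var (just (j , i))

⊤f : Fm TV → Fm TV
⊤f x = x ⇒ x

_⇛_ : List (Fm TV) → Fm TV → Fm TV
Γ ⇛ φ = foldr _⇒_ φ Γ

upto : ℕ → (ℕ → Fm TV) → List (Fm TV)
upto zero    f = []
upto (suc k) f = upto k f ++ (f (suc k) ∷ [])

bold : ℕ → Fm ℕ → List (Fm TV)
bold k (var j) = upto k (λ i → x[ j , i ])
bold k 𝟙       = ⊤f x[ 0 , 1 ] ∷ []
bold k 𝟘       = x[ 0 , 1 ] ∷ (x[ 0 , 1 ] ⇒ 𝟘) ∷ []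
bold k (φ ∧̇ ψ) = bold k φ ++ bold k ψ
bold k (¬̇ φ)   = (bold k φ ⇛ 𝟘) ∷ []
bold k (φ ⇒ ψ) = map (λ χ → bold k φ ⇛ χ) (bold k ψ)
bold k (φ ∨̇ ψ) = concatMap (λ a → map (λ b → a ∨̇ b) (bold k ψ)) (bold k φ)

yv : Fm TV
yv = var nothing

-- the k-th member of 𝗔(Φ):
--   ((𝛗₁^k → y) ∪ ⋯ ∪ (𝛗ₘ^k → y)) → y
𝔸 : List⁺ (Fm ℕ) → ℕ → Fm TV
𝔸 φs k = map (λ φ → bold k φ ⇛ yv) (toList φs) ⇛ yv

module _ {c ℓ₁ ℓ₂ : Level} (H : HeytingAlgebra c ℓ₁ ℓ₂) where
  open HeytingAlgebra H

  evalH : {V : Set} → (V → Carrier) → Fm V → Carrier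
  evalH v (var x) = v x
  evalH v (φ ∧̇ ψ) = evalH v φ ∧ evalH v ψ
  evalH v (φ ∨̇ ψ) = evalH v φ ∨ evalH v ψ
  evalH v (φ ⇒ ψ) = evalH v φ ⇨ evalH v ψ
  evalH v (¬̇ φ)   = evalH v φ ⇨ ⊥
  evalH v 𝟘       = ⊥
  evalH v 𝟙       = ⊤

  record IsSubreduct (L : Lang) {a : Level} (A : Carrier → Set a) : Set (c ⊔ ℓ₁ ⊔ a) where
    field
      resp     : ∀ {x y} → x ≈ y → A x → A y
      nonempty : Σ Carrier A
      cl⇒ : ∀ {x y} → A x → A y → A (x ⇨ y)
      cl∧ : T (has∧ L) → ∀ {x y} → A x → A y → A (x ∧ y)
      cl∨ : T (has∨ L) → ∀ {x y} → A x → A y → A (x ∨ y)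
      cl¬ : T (has¬ L) → ∀ {x} → A x → A (x ⇨ ⊥)
      cl0 : T (has0 L) → A ⊥
      cl1 : T (has1 L) → A ⊤

  module _ {a : Level} (A : Carrier → Set a) where

    El : Set (c ⊔ a)
    El = Σ Carrier A

    ValidIn : {V : Set} → Fm V → Set (c ⊔ ℓ₁ ⊔ a)
    ValidIn {V} φ = (v : V → Carrier) → (∀ x → A (v x)) → evalH v φ ≈ ⊤

    module Filters (cl⇒ : ∀ {x y} → A x → A y → A (x ⇨ y)) where

      _⇒ₐ_ : El → El → El
      (x , p) ⇒ₐ (y , q) = (x ⇨ y) , cl⇒ p q

      record ImpFilter : Set (lsuc (c ⊔ ℓ₁ ⊔ a)) where
        field
          mem  : El → Set (c ⊔ ℓ₁ ⊔ a)
          resp : ∀ {e e'} → proj₁ e ≈ proj₁ e' → mem e → mem e'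
          one  : ∀ e → mem (e ⇒ₐ e)                       -- 1 = x → x
          mp   : ∀ {e f} → mem e → mem (e ⇒ₐ f) → mem f
      open ImpFilter public

      _⊆F_ : ImpFilter → ImpFilter → Set (c ⊔ ℓ₁ ⊔ a)
      F ⊆F G = ∀ e → mem F e → mem G e

      _≐F_ : ImpFilter → ImpFilter → Set (c ⊔ ℓ₁ ⊔ a)
      F ≐F G = F ⊆F G × G ⊆F F

      IsMeet : ImpFilter → ImpFilter → ImpFilter → Set (c ⊔ ℓ₁ ⊔ a)
      IsMeet F G K = ∀ e → (mem F e → mem G e × mem K e) × (mem G e × mem K e → mem F e)

      Proper : ImpFilter → Set (c ⊔ ℓ₁ ⊔ a)
      Proper F = ¬ (∀ e → mem F e)

      MeetIrreducible : ImpFilter → Set (lsuc (c ⊔ ℓ₁ ⊔ a))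
      MeetIrreducible F =
        Proper F × ¬ (Σ ImpFilter λ G → Σ ImpFilter λ K →
                        ¬ (G ≐F F) × ¬ (K ≐F F) × IsMeet F G K)

      A* : Set (lsuc (c ⊔ ℓ₁ ⊔ a))
      A* = Σ ImpFilter MeetIrreducible

      _≤*_ : A* → A* → Set (c ⊔ ℓ₁ ⊔ a)
      (F , _) ≤* (G , _) = F ⊆F G

-- The Heyting algebra Up(𝕏) of upsets of a (pre)ordered set, and
-- validity in it.  U → V = X ∖ ↓(U ∖ V),  ¬U = U → ∅.

module UpSem {x r : Level} (X : Set x) (_≤_ : X → X → Set r) where

  Upset : Set (lsuc (x ⊔ r))
  Upset = Σ (X → Set (x ⊔ r)) λ U → ∀ {p q} → p ≤ q → U p → U q

  ⟦_⟧ : {V : Set} → Fm V → (V → Upset) → X → Set (x ⊔ r)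
  ⟦ var v ⟧ ρ p = proj₁ (ρ v) p
  ⟦ φ ∧̇ ψ ⟧ ρ p = ⟦ φ ⟧ ρ p × ⟦ ψ ⟧ ρ p
  ⟦ φ ∨̇ ψ ⟧ ρ p = ⟦ φ ⟧ ρ p ⊎ ⟦ ψ ⟧ ρ p
  ⟦ φ ⇒ ψ ⟧ ρ p = ¬ (Σ X λ q → p ≤ q × ⟦ φ ⟧ ρ q × ¬ ⟦ ψ ⟧ ρ q)
  ⟦ ¬̇ φ ⟧   ρ p = ¬ (Σ X λ q → p ≤ q × ⟦ φ ⟧ ρ q)
  ⟦ 𝟘 ⟧     ρ p = Lift (x ⊔ r) Empty
  ⟦ 𝟙 ⟧     ρ p = Lift (x ⊔ r) Unit

  ValidUp : {V : Set} → Fm V → Set (lsuc (x ⊔ r))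
  ValidUp {V} φ = (ρ : V → Upset) → ∀ p → ⟦ φ ⟧ ρ p

-- Classical metatheory (ZFC) made explicit: Zorn's lemma for preorders

Chain : ∀ {a r} {P : Set a} → (P → P → Set r) → ∀ {s} → (P → Set s) → Set (a ⊔ r ⊔ s)
Chain _≤_ C = ∀ x y → C x → C y → x ≤ y ⊎ y ≤ x

Zorn : ∀ a r s → Set (lsuc (a ⊔ r ⊔ s))
Zorn a r s = (P : Set a) (_≤_ : P → P → Set r) → IsPreorder _≡_ _≤_ →
  ((C : P → Set s) → Chain _≤_ C → Σ P λ u → ∀ p → C p → p ≤ u) →
  Σ P λ m → ∀ p → m ≤ p → p ≤ m

{-# OPTIONS --safe #-}
module Submission where

-- In Up(A_*), validity of 𝗔(Φ) says that every valuation ρ and every point p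
-- satisfy p ⊨ φᵢ for some i.  If all φᵢ fail at p, this is witnessed by a
-- finite list Q of points above p, and the φᵢ still fail under the smaller
-- valuation ρ₀ sending a variable to the upset generated by the points of Q
-- that satisfy it.  Each ρ₀(x) is the intersection of a down-directed family of
-- sets {F : w(x) ∈ F}, where w(x) runs over finite meets of elements of A.
-- Along this family the truth of negative formulas at a point, and the failure
-- of positive ones, already occurs at some w; for implications this is Esakia's
-- lemma, obtained from Zorn's lemma.  Hence some w refutes every φᵢ
-- algebraically, i.e. φᵢ(w) lies outside the filter generated by p.  By meet
-- irreducibility some y ∉ p has φᵢ(w) → y in that filter for all i,
-- contradicting the validity in A of the member of 𝗔(Φ) for the size of w.

open import Defs
open import Level using (Level; _⊔_; Lift; lift; lower; 0ℓ) renaming (suc to lsuc)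
open import Axiom.ExcludedMiddle using (ExcludedMiddle)
open import Data.Bool using (T)
open import Data.List using (List; []; _∷_; _++_; map; concatMap)
open import Data.List.Membership.Propositional using (_∈_)
open import Data.List.Membership.Propositional.Properties using (∈-++⁺ˡ; ∈-++⁺ʳ)
open import Data.List.NonEmpty using (toList)
open import Data.List.Relation.Unary.All as All using (All; []; _∷_)
open import Data.List.Relation.Unary.All.Properties using (++⁺; ++⁻; map⁺; map⁻; concat⁺)
open import Data.List.Relation.Unary.Any using (here)
open import Data.Maybe using (just; nothing)
open import Data.Nat using (ℕ; zero; suc; _+_; _∸_; _≤?_; _≟_; s≤s) renaming (_≤_ to _≤ⁿ_)
open import Data.Nat.Properties using (m+n∸n≡m; 1+n≰n; ≤-refl; m≤n⇒m≤1+n; m≤n+m)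
  renaming (≤-trans to ≤ⁿ-trans)
open import Data.Product using (Σ; _×_; _,_; proj₁; proj₂)
open import Data.Sum using (_⊎_; inj₁; inj₂; [_,_]′)
open import Data.Unit using (tt)
open import Function using (_∘_; id)
open import Relation.Binary.Lattice.Bundles using (HeytingAlgebra)
open import Relation.Binary.PropositionalEquality using (_≡_; refl) renaming (isEquivalence to ≡-isEquivalence)
open import Relation.Nullary using (¬_; Dec; yes; no; contradiction)
open import Relation.Nullary.Decidable using (True; fromWitness; toWitness; decidable-stable)

private
  variable
    b i ℓ : Level

-- Finite meets in a Heyting algebra and the algebraic value of translated formulas.

module HeytingMeets {c ℓ₁ ℓ₂ : Level} (H : HeytingAlgebra c ℓ₁ ℓ₂) where

  open HeytingAlgebra H renaming (refl to ≤-rfl; trans to ≤-trans)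
  open import Relation.Binary.Lattice.Properties.HeytingAlgebra H
    using (⇨-unit; ⇨-eval; ⇨-relax; ⇨-cong; ⇨-curry; ⇨-distribˡ-∧; ⇨-applyʳ; distributiveLattice)
  open import Relation.Binary.Lattice.Properties.MeetSemilattice meetSemilattice
    using (∧-assoc; ∧-cong; ∧-monotonic)
  open import Relation.Binary.Lattice.Properties.JoinSemilattice joinSemilattice
    using (∨-cong; ∨-monotonic)
  open import Relation.Binary.Lattice.Properties.BoundedMeetSemilattice boundedMeetSemilattice
    using (identityˡ; identityʳ)
  open import Relation.Binary.Lattice.Properties.BoundedLattice boundedLattice
    using (∨-zeroˡ; ∨-zeroʳ)
  open import Relation.Binary.Lattice.Properties.DistributiveLattice distributiveLattice
    using (∨-distribˡ-∧; ∨-distribʳ-∧)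
  open import Relation.Binary.Reasoning.PartialOrder poset

  ⋀ : {B : Set b} → (B → Carrier) → List B → Carrier
  ⋀ f []       = ⊤
  ⋀ f (x ∷ xs) = f x ∧ ⋀ f xs

  module _ {B : Set b} (f : B → Carrier) where

    ⋀-++ : ∀ xs ys → ⋀ f (xs ++ ys) ≈ ⋀ f xs ∧ ⋀ f ys
    ⋀-++ []       ys = Eq.sym (identityˡ _)
    ⋀-++ (x ∷ xs) ys = Eq.trans (∧-cong Eq.refl (⋀-++ xs ys)) (Eq.sym (∧-assoc _ _ _))

    ⋀-++-≤ˡ : ∀ xs ys → ⋀ f (xs ++ ys) ≤ ⋀ f xs
    ⋀-++-≤ˡ xs ys = ≤-trans (reflexive (⋀-++ xs ys)) (x∧y≤x _ _)

    ⋀-++-≤ʳ : ∀ xs ys → ⋀ f (xs ++ ys) ≤ ⋀ f ys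
    ⋀-++-≤ʳ xs ys = ≤-trans (reflexive (⋀-++ xs ys)) (x∧y≤y _ _)

    ⋀-lower : ∀ xs → All (λ x → ⋀ f xs ≤ f x) xs
    ⋀-lower []       = []
    ⋀-lower (x ∷ xs) = x∧y≤x _ _ ∷ All.map (≤-trans (x∧y≤y _ _)) (⋀-lower xs)

    ⋀-map-⇨ : ∀ {B′ : Set b} (g : B′ → B) (h : B′ → Carrier) a → (∀ x → f (g x) ≈ a ⇨ h x) →
              ∀ xs → ⋀ f (map g xs) ≈ a ⇨ ⋀ h xs
    ⋀-map-⇨ g h a eq []       = antisym (transpose-⇨ (maximum _)) (maximum _)
    ⋀-map-⇨ g h a eq (x ∷ xs) =
      Eq.trans (∧-cong (eq x) (⋀-map-⇨ g h a eq xs)) (Eq.sym (⇨-distribˡ-∧ a _ _))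

    ⋀-map-∨ : ∀ {B′ : Set b} (g : B′ → B) (h : B′ → Carrier) a → (∀ x → f (g x) ≈ a ∨ h x) →
              ∀ xs → ⋀ f (map g xs) ≈ a ∨ ⋀ h xs
    ⋀-map-∨ g h a eq []       = Eq.sym (∨-zeroʳ a)
    ⋀-map-∨ g h a eq (x ∷ xs) =
      Eq.trans (∧-cong (eq x) (⋀-map-∨ g h a eq xs)) (Eq.sym (∨-distribˡ-∧ a _ _))

    ⋀-concatMap-∨ : ∀ {B′ : Set b} (g : B′ → List B) (h : B′ → Carrier) a →
                    (∀ x → ⋀ f (g x) ≈ h x ∨ a) → ∀ xs → ⋀ f (concatMap g xs) ≈ ⋀ h xs ∨ a
    ⋀-concatMap-∨ g h a eq []       = Eq.sym (∨-zeroˡ a)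
    ⋀-concatMap-∨ g h a eq (x ∷ xs) = Eq.trans (⋀-++ (g x) _)
      (Eq.trans (∧-cong (eq x) (⋀-concatMap-∨ g h a eq xs)) (Eq.sym (∨-distribʳ-∧ a _ _)))

  module _ (v : TV → Carrier) where

    evalH-⇛ : ∀ Γ φ → evalH H v (Γ ⇛ φ) ≈ ⋀ (evalH H v) Γ ⇨ evalH H v φ
    evalH-⇛ []      φ = antisym (transpose-⇨ (x∧y≤x _ _)) (≤-trans (∧-greatest ≤-rfl (maximum _)) ⇨-eval)
    evalH-⇛ (γ ∷ Γ) φ = Eq.trans (⇨-cong Eq.refl (evalH-⇛ Γ φ)) (Eq.sym ⇨-curry)

    module _ {u : ℕ → Carrier} (k : ℕ) (vars : ∀ j → ⋀ (evalH H v) (bold k (var j)) ≈ u j) where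

      -- Each clause of the translation mirrors a Heyting identity: implication preserves meets in
      -- its consequent and curries, and joins distribute over finite meets. So the value of `φ` in
      -- `H`, which may lie outside `A`, is reached through formulas without conjunction.
      ⋀-bold : ∀ φ → ⋀ (evalH H v) (bold k φ) ≈ evalH H u φ
      ⋀-bold (var j) = vars j
      ⋀-bold (φ ∧̇ ψ) = Eq.trans (⋀-++ _ (bold k φ) _) (∧-cong (⋀-bold φ) (⋀-bold ψ))
      ⋀-bold (φ ∨̇ ψ) = Eq.trans
        (⋀-concatMap-∨ _ _ (evalH H v) _
          (λ χ → ⋀-map-∨ _ (χ ∨̇_) (evalH H v) (evalH H v χ) (λ _ → Eq.refl) (bold k ψ)) (bold k φ))
        (∨-cong (⋀-bold φ) (⋀-bold ψ))
      ⋀-bold (φ ⇒ ψ) = Eq.trans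
        (⋀-map-⇨ _ (bold k φ ⇛_) (evalH H v) _ (evalH-⇛ (bold k φ)) (bold k ψ))
        (⇨-cong (⋀-bold φ) (⋀-bold ψ))
      ⋀-bold (¬̇ φ) = Eq.trans (identityʳ _)
        (Eq.trans (evalH-⇛ (bold k φ) 𝟘) (⇨-cong (⋀-bold φ) Eq.refl))
      ⋀-bold 𝟘 = antisym
        (≤-trans (∧-monotonic ≤-rfl (x∧y≤x _ _)) (⇨-applyʳ ≤-rfl)) (minimum _)
      ⋀-bold 𝟙 = Eq.trans (identityʳ _) ⇨-unit

  module _ {V : Set} {u v : V → Carrier} (u≤v : ∀ j → u j ≤ v j) where

    mutual
      evalH-monotone : ∀ φ → Pos φ → evalH H u φ ≤ evalH H v φ
      evalH-monotone (var x) _       = u≤v x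
      evalH-monotone (φ ∧̇ ψ) (p , q) = ∧-monotonic (evalH-monotone φ p) (evalH-monotone ψ q)
      evalH-monotone (φ ∨̇ ψ) (p , q) = ∨-monotonic (evalH-monotone φ p) (evalH-monotone ψ q)
      evalH-monotone (φ ⇒ ψ) (p , q) = ⇨-relax (evalH-antitone φ p) (evalH-monotone ψ q)
      evalH-monotone (¬̇ φ)   p       = ⇨-relax (evalH-antitone φ p) ≤-rfl
      evalH-monotone 𝟘       _       = ≤-rfl
      evalH-monotone 𝟙       _       = ≤-rfl

      evalH-antitone : ∀ φ → Neg φ → evalH H v φ ≤ evalH H u φ
      evalH-antitone (φ ∧̇ ψ) (p , q) = ∧-monotonic (evalH-antitone φ p) (evalH-antitone ψ q)
      evalH-antitone (φ ∨̇ ψ) (p , q) = ∨-monotonic (evalH-antitone φ p) (evalH-antitone ψ q)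
      evalH-antitone (φ ⇒ ψ) (p , q) = ⇨-relax (evalH-monotone φ p) (evalH-antitone ψ q)
      evalH-antitone (¬̇ φ)   p       = ⇨-relax (evalH-monotone φ p) ≤-rfl
      evalH-antitone 𝟘       _       = ≤-rfl
      evalH-antitone 𝟙       _       = ≤-rfl

  module _ (h : Fm TV → Carrier) (g : ℕ → Fm TV) (m : ℕ) where

    ⋀-upto-≤ˡ : ∀ n → ⋀ h (upto (n + m) g) ≤ ⋀ h (upto m g)
    ⋀-upto-≤ˡ zero    = ≤-rfl
    ⋀-upto-≤ˡ (suc n) = ≤-trans (⋀-++-≤ˡ h (upto (n + m) g) _) (⋀-upto-≤ˡ n)

    ⋀-upto-≤ʳ : ∀ n → ⋀ h (upto (n + m) g) ≤ ⋀ h (upto n (λ i → g (i + m)))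
    ⋀-upto-≤ʳ zero    = maximum _
    ⋀-upto-≤ʳ (suc n) = begin
      ⋀ h (upto (n + m) g ++ _)                        ≈⟨ ⋀-++ h (upto (n + m) g) _ ⟩
      ⋀ h (upto (n + m) g) ∧ _                         ≤⟨ ∧-monotonic (⋀-upto-≤ʳ n) ≤-rfl ⟩
      ⋀ h (upto n (λ i → g (i + m))) ∧ _               ≈⟨ ⋀-++ h (upto n (λ i → g (i + m))) _ ⟨
      ⋀ h (upto n (λ i → g (i + m)) ++ _)              ∎

  -- The bound `suc i ≤ⁿ k` is handed to the hypothesis because merged approximations can be
  -- compared only on the indices actually listed.
  ⋀-upto-mono : ∀ h h′ (g g′ : ℕ → Fm TV) k → (∀ i → suc i ≤ⁿ k → h (g (suc i)) ≤ h′ (g′ (suc i))) →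
                ⋀ h (upto k g) ≤ ⋀ h′ (upto k g′)
  ⋀-upto-mono h h′ g g′ zero    le = ≤-rfl
  ⋀-upto-mono h h′ g g′ (suc k) le = begin
    ⋀ h (upto k g ++ _)      ≈⟨ ⋀-++ h (upto k g) _ ⟩
    ⋀ h (upto k g) ∧ _       ≤⟨ ∧-monotonic (⋀-upto-mono h h′ g g′ k (λ i → le i ∘ m≤n⇒m≤1+n))
                                            (∧-monotonic (le k ≤-refl) ≤-rfl) ⟩
    ⋀ h′ (upto k g′) ∧ _     ≈⟨ ⋀-++ h′ (upto k g′) _ ⟨
    ⋀ h′ (upto k g′ ++ _)    ∎

-- Forcing over a preorder and the translation read in its upsets.

module UpMeets (em : ∀ {ℓ} → ExcludedMiddle ℓ) {x r : Level} {X : Set x} (_≤_ : X → X → Set r)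
  (≤-rfl : ∀ {p} → p ≤ p) (≤-trans : ∀ {p q s} → p ≤ q → q ≤ s → p ≤ s) where

  open UpSem X _≤_

  module _ {V : Set} where

    ⇒-intro : (φ ψ : Fm V) → ∀ {ρ p} → (∀ {q} → p ≤ q → ⟦ φ ⟧ ρ q → ⟦ ψ ⟧ ρ q) → ⟦ φ ⇒ ψ ⟧ ρ p
    ⇒-intro φ ψ h (q , p≤q , φq , ¬ψq) = ¬ψq (h p≤q φq)

    -- The semantics phrases implication as a negated existential; excluded middle recovers the
    -- usual forcing clause.
    ⇒-elim : (φ ψ : Fm V) → ∀ {ρ p q} → ⟦ φ ⇒ ψ ⟧ ρ p → p ≤ q → ⟦ φ ⟧ ρ q → ⟦ ψ ⟧ ρ q
    ⇒-elim φ ψ h p≤q φq = decidable-stable em λ ¬ψq → h (_ , p≤q , φq , ¬ψq)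

    persistent : (φ : Fm V) → ∀ {ρ p q} → p ≤ q → ⟦ φ ⟧ ρ p → ⟦ φ ⟧ ρ q
    persistent (var v) {ρ} p≤q         = proj₂ (ρ v) p≤q
    persistent (φ ∧̇ ψ) p≤q (h , h′)    = persistent φ p≤q h , persistent ψ p≤q h′
    persistent (φ ∨̇ ψ) p≤q (inj₁ h)    = inj₁ (persistent φ p≤q h)
    persistent (φ ∨̇ ψ) p≤q (inj₂ h)    = inj₂ (persistent ψ p≤q h)
    persistent (φ ⇒ ψ) p≤q h (s , q≤s , w) = h (s , ≤-trans p≤q q≤s , w)
    persistent (¬̇ φ)   p≤q h (s , q≤s , w) = h (s , ≤-trans p≤q q≤s , w)
    persistent 𝟙       p≤q _           = lift tt

    module _ {ρ₀ ρ : V → Upset} (ρ₀⊆ρ : ∀ v {p} → proj₁ (ρ₀ v) p → proj₁ (ρ v) p) where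

      mutual
        ⟦⟧-monotone : ∀ φ → Pos φ → ∀ {p} → ⟦ φ ⟧ ρ₀ p → ⟦ φ ⟧ ρ p
        ⟦⟧-monotone (var v) _ h              = ρ₀⊆ρ v h
        ⟦⟧-monotone (φ ∧̇ ψ) (p , q) (h , h′) = ⟦⟧-monotone φ p h , ⟦⟧-monotone ψ q h′
        ⟦⟧-monotone (φ ∨̇ ψ) (p , q) (inj₁ h) = inj₁ (⟦⟧-monotone φ p h)
        ⟦⟧-monotone (φ ∨̇ ψ) (p , q) (inj₂ h) = inj₂ (⟦⟧-monotone ψ q h)
        ⟦⟧-monotone (φ ⇒ ψ) (p , q) h (s , le , φs , ¬ψs) =
          h (s , le , ⟦⟧-antitone φ p φs , ¬ψs ∘ ⟦⟧-monotone ψ q)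
        ⟦⟧-monotone (¬̇ φ)   p h (s , le , φs) = h (s , le , ⟦⟧-antitone φ p φs)
        ⟦⟧-monotone 𝟙       _ h              = h

        ⟦⟧-antitone : ∀ φ → Neg φ → ∀ {p} → ⟦ φ ⟧ ρ p → ⟦ φ ⟧ ρ₀ p
        ⟦⟧-antitone (φ ∧̇ ψ) (p , q) (h , h′) = ⟦⟧-antitone φ p h , ⟦⟧-antitone ψ q h′
        ⟦⟧-antitone (φ ∨̇ ψ) (p , q) (inj₁ h) = inj₁ (⟦⟧-antitone φ p h)
        ⟦⟧-antitone (φ ∨̇ ψ) (p , q) (inj₂ h) = inj₂ (⟦⟧-antitone ψ q h)
        ⟦⟧-antitone (φ ⇒ ψ) (p , q) h (s , le , φs , ¬ψs) =
          h (s , le , ⟦⟧-monotone φ p φs , ¬ψs ∘ ⟦⟧-antitone ψ q)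
        ⟦⟧-antitone (¬̇ φ)   p h (s , le , φs) = h (s , le , ⟦⟧-monotone φ p φs)
        ⟦⟧-antitone 𝟙       _ h              = h

  module _ (ρ : TV → Upset) where

    ⇛-intro : ∀ Γ φ {p} → (∀ {q} → p ≤ q → All (λ γ → ⟦ γ ⟧ ρ q) Γ → ⟦ φ ⟧ ρ q) → ⟦ Γ ⇛ φ ⟧ ρ p
    ⇛-intro []      φ h = h ≤-rfl []
    ⇛-intro (γ ∷ Γ) φ h = ⇒-intro γ (Γ ⇛ φ) λ p≤q γq →
      ⇛-intro Γ φ λ q≤s Γs → h (≤-trans p≤q q≤s) (persistent γ q≤s γq ∷ Γs)

    ⇛-elim : ∀ Γ φ {p q} → ⟦ Γ ⇛ φ ⟧ ρ p → p ≤ q → All (λ γ → ⟦ γ ⟧ ρ q) Γ → ⟦ φ ⟧ ρ q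
    ⇛-elim []      φ h p≤q []        = persistent φ p≤q h
    ⇛-elim (γ ∷ Γ) φ h p≤q (γq ∷ Γq) = ⇛-elim Γ φ (⇒-elim γ (Γ ⇛ φ) h p≤q γq) ≤-rfl Γq

    -- Intersections of upsets are upsets, so a valuation of the `k` copies of each variable
    -- collapses to an ordinary valuation of the original variables.
    ⋂ : ℕ → ℕ → Upset
    ⋂ k j = (λ p → All (λ χ → ⟦ χ ⟧ ρ p) (bold k (var j))) ,
            λ p≤q → All.map (λ {χ} → persistent χ p≤q)

    -- If some `γ` fails at `p`, the disjunctions formed with it force every member of `Δ`.
    All-∨ : ∀ {p} Γ Δ → All (λ χ → ⟦ χ ⟧ ρ p) (concatMap (λ γ → map (γ ∨̇_) Δ) Γ) →
            All (λ χ → ⟦ χ ⟧ ρ p) Γ ⊎ All (λ χ → ⟦ χ ⟧ ρ p) Δ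
    All-∨ [] Δ h = inj₁ []
    All-∨ {p} (γ ∷ Γ) Δ h with ++⁻ (map (γ ∨̇_) Δ) h
    ... | hγ , hΓ with All-∨ Γ Δ hΓ | em {P = ⟦ γ ⟧ ρ p}
    ... | inj₂ d | _      = inj₂ d
    ... | inj₁ g | yes γp = inj₁ (γp ∷ g)
    ... | inj₁ g | no ¬γp =
      inj₂ (All.map (λ { (inj₁ γp) → contradiction γp ¬γp ; (inj₂ d) → d }) (map⁻ hγ))

    mutual
      bold-sound : ∀ k φ {p} → ⟦ φ ⟧ (⋂ k) p → All (λ χ → ⟦ χ ⟧ ρ p) (bold k φ)
      bold-sound k (var j) h        = h
      bold-sound k (φ ∧̇ ψ) (h , h′) = ++⁺ (bold-sound k φ h) (bold-sound k ψ h′)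
      bold-sound k (φ ∨̇ ψ) (inj₁ h) = concat⁺ (map⁺ (All.map
        (λ γp → map⁺ (All.universal (λ _ → inj₁ γp) _)) (bold-sound k φ h)))
      bold-sound k (φ ∨̇ ψ) (inj₂ h) = concat⁺ (map⁺ (All.universal
        (λ γ → map⁺ {f = γ ∨̇_} (All.map inj₂ (bold-sound k ψ h))) (bold k φ)))
      bold-sound k (φ ⇒ ψ) h = map⁺ (All.tabulate λ {χ} χ∈ → ⇛-intro (bold k φ) χ λ p≤q hφ →
        All.lookup (bold-sound k ψ (⇒-elim φ ψ h p≤q (bold-complete k φ hφ))) χ∈)
      bold-sound k (¬̇ φ) h = ⇛-intro (bold k φ) 𝟘
        (λ p≤q hφ → contradiction (_ , p≤q , bold-complete k φ hφ) h) ∷ []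
      bold-sound k 𝟙 _ = ⇒-intro x[ 0 , 1 ] x[ 0 , 1 ] {ρ} (λ _ h → h) ∷ []

      bold-complete : ∀ k φ {p} → All (λ χ → ⟦ χ ⟧ ρ p) (bold k φ) → ⟦ φ ⟧ (⋂ k) p
      bold-complete k (var j) h = h
      bold-complete k (φ ∧̇ ψ) h = let hφ , hψ = ++⁻ (bold k φ) h in
        bold-complete k φ hφ , bold-complete k ψ hψ
      bold-complete k (φ ∨̇ ψ) h = [ inj₁ ∘ bold-complete k φ , inj₂ ∘ bold-complete k ψ ]′
        (All-∨ (bold k φ) (bold k ψ) h)
      bold-complete k (φ ⇒ ψ) h = ⇒-intro φ ψ λ p≤q hφ → bold-complete k ψ
        (All.map (λ {χ} hχ → ⇛-elim (bold k φ) χ hχ p≤q (bold-sound k φ hφ)) (map⁻ h))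
      bold-complete k (¬̇ φ) (h ∷ []) (q , p≤q , hφ) = lower (⇛-elim (bold k φ) 𝟘 h p≤q (bold-sound k φ hφ))
      bold-complete k 𝟘 (h ∷ h′ ∷ []) = ⇒-elim x[ 0 , 1 ] 𝟘 {ρ} h′ ≤-rfl h
      bold-complete k 𝟙 _ = lift tt

-- Implicative filters of `A` and the filters of `H` they generate.

module FilterTheory (em : ∀ {ℓ} → ExcludedMiddle ℓ) (zorn : ∀ {a r s} → Zorn a r s)
  {c ℓ₁ ℓ₂ a : Level} (L : Lang) (H : HeytingAlgebra c ℓ₁ ℓ₂)
  (A : HeytingAlgebra.Carrier H → Set a) (sub : IsSubreduct H L A) where

  open HeytingAlgebra H renaming (refl to ≤-rfl; trans to ≤-trans)
  open import Relation.Binary.Lattice.Properties.HeytingAlgebra H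
    using (⇨-unit; ⇨-eval; ⇨ʳ-covariant; ⇨-relax; ⇨-cong; ⇨-distribˡ-∧-≥; ⇨-distribˡ-∨-∧-≥; y≤x⇨y;
           swap-transpose-⇨; ⇨-applyʳ)
  open import Relation.Binary.Lattice.Properties.MeetSemilattice meetSemilattice
    using (∧-cong; ∧-monotonic)
  open HeytingMeets H
  open IsSubreduct sub hiding (resp)
  open Filters H A cl⇒

  dne : ∀ {P : Set ℓ} → ¬ ¬ P → P
  dne = decidable-stable em

  infix 4 _⊩_

  -- Membership in the filter of `H` generated by `F`. Formulas are evaluated in `H` and their
  -- values may leave `A`, where `mem F` says nothing.
  record _⊩_ (F : ImpFilter) (x : Carrier) : Set (c ⊔ ℓ₁ ⊔ ℓ₂ ⊔ a) where
    constructor via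
    field
      {members} : List (El H A)
      members∈  : All (mem F) members
      ⋀members≤ : ⋀ proj₁ members ≤ x

  MeetOfA : Carrier → Set _
  MeetOfA x = Σ (List (El H A)) λ es → x ≈ ⋀ proj₁ es

  module _ {F : ImpFilter} where

    ⊩-up : ∀ {x y} → x ≤ y → F ⊩ x → F ⊩ y
    ⊩-up x≤y (via es∈F le) = via es∈F (≤-trans le x≤y)

    ⊩-⊤ : F ⊩ ⊤
    ⊩-⊤ = via [] ≤-rfl

    ⊩-∧ : ∀ {x y} → F ⊩ x → F ⊩ y → F ⊩ x ∧ y
    ⊩-∧ (via {es} es∈F le) (via {ds} ds∈F le′) = via (++⁺ es∈F ds∈F)
      (∧-greatest (≤-trans (⋀-++-≤ˡ proj₁ es ds) le) (≤-trans (⋀-++-≤ʳ proj₁ es ds) le′))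

    ⊩-mp : ∀ {x y} → F ⊩ x ⇨ y → F ⊩ x → F ⊩ y
    ⊩-mp h h′ = ⊩-up ⇨-eval (⊩-∧ h h′)

    ⊩-⋀ : ∀ {B : Set b} (f : B → Carrier) {xs} → All (λ x → F ⊩ f x) xs → F ⊩ ⋀ f xs
    ⊩-⋀ f []       = ⊩-⊤
    ⊩-⋀ f (h ∷ hs) = ⊩-∧ h (⊩-⋀ f hs)

    mem⇒⊩ : ∀ {e} → mem F e → F ⊩ proj₁ e
    mem⇒⊩ {e} e∈F = via {members = e ∷ []} (e∈F ∷ []) (x∧y≤x _ _)

    -- The generated filter adds nothing inside `A`: an inequality between a finite meet and `e`
    -- curries into a nested implication equal to 1, from which the members of `F` are detached by
    -- modus ponens.
    ⊩⇒mem : ∀ {e} → F ⊩ proj₁ e → mem F e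
    ⊩⇒mem (via es∈F le) = detach es∈F le
      where
      detach : ∀ {es e} → All (mem F) es → ⋀ proj₁ es ≤ proj₁ e → mem F e
      detach {e = e} []       le = resp F (Eq.trans ⇨-unit (antisym le (maximum _))) (one F e)
      detach (d∈F ∷ ds∈F) le = mp F d∈F (detach ds∈F (swap-transpose-⇨ le))

    mem-up : ∀ d e → proj₁ d ≤ proj₁ e → mem F d → mem F e
    mem-up d e d≤e d∈F = ⊩⇒mem (⊩-up d≤e (mem⇒⊩ d∈F))

    -- If all the finitely many factors of `x` were in `F`, their meet would be forced.
    ⊮⇒∉ : ∀ {x} → MeetOfA x → ¬ F ⊩ x → Σ (El H A) λ e → ¬ mem F e × x ≤ proj₁ e
    ⊮⇒∉ (es , x≈) F⊮x = dne λ none → F⊮x (⊩-up (reflexive (Eq.sym x≈)) (⊩-⋀ proj₁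
      (All.map (λ {e} ⋀≤e → mem⇒⊩ (dne λ e∉F → none (e , e∉F , ≤-trans (reflexive x≈) ⋀≤e)))
        (⋀-lower proj₁ es))))

  ⊩-mono : ∀ {F G x} → F ⊆F G → F ⊩ x → G ⊩ x
  ⊩-mono F⊆G (via es∈F le) = via (All.map (F⊆G _) es∈F) le

  -- Membership in an ImpFilter has a fixed universe level; excluded middle
  -- lets the trace of a filter of H of any level be resized to it.
  record HFilter (U : Carrier → Set ℓ) : Set (c ⊔ ℓ₂ ⊔ ℓ) where
    field
      up   : ∀ {x y} → x ≤ y → U x → U y
      top  : U ⊤
      meet : ∀ {x y} → U x → U y → U (x ∧ y)

  module _ {U : Carrier → Set ℓ} (isF : HFilter U) where

    open HFilter isF

    trace : ImpFilter
    trace = record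
      { mem  = λ e → Lift _ (True (em {P = U (proj₁ e)}))
      ; resp = λ e≈ h → lift (fromWitness (up (reflexive e≈) (toWitness (lower h))))
      ; one  = λ e → lift (fromWitness (up (reflexive (Eq.sym ⇨-unit)) top))
      ; mp   = λ h h′ → lift (fromWitness
                 (up ⇨-eval (meet (toWitness (lower h′)) (toWitness (lower h)))))
      }

    mem-trace⁺ : ∀ e → U (proj₁ e) → mem trace e
    mem-trace⁺ e = lift ∘ fromWitness

    mem-trace⁻ : ∀ e → mem trace e → U (proj₁ e)
    mem-trace⁻ e = toWitness ∘ lower

    ⋀-trace : ∀ {es} → All (mem trace) es → U (⋀ proj₁ es)
    ⋀-trace []       = top
    ⋀-trace {e ∷ _} (h ∷ hs) = meet (mem-trace⁻ e h) (⋀-trace hs)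

    ⊩-trace⁻ : ∀ {x} → trace ⊩ x → U x
    ⊩-trace⁻ (via es∈ le) = up le (⋀-trace es∈)

    -- The factors of `x` lie above it, hence in `U`, and they belong to `A`, so the trace retains
    -- enough to regenerate `x`.
    ⊩-trace⁺ : ∀ {x} → MeetOfA x → U x → trace ⊩ x
    ⊩-trace⁺ (es , x≈) Ux = ⊩-up (reflexive (Eq.sym x≈)) (⊩-⋀ proj₁
      (All.map (λ {e} ⋀≤e → mem⇒⊩ {trace} {e} (mem-trace⁺ e (up (≤-trans (reflexive x≈) ⋀≤e) Ux))) (⋀-lower proj₁ es)))

  -- By the deduction theorem this is the filter of `H` generated by `F` together with `x`.
  residual-isFilter : ∀ F x → HFilter (λ y → F ⊩ x ⇨ y)
  residual-isFilter F x = record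
    { up   = λ y≤z → ⊩-up (⇨ʳ-covariant y≤z)
    ; top  = ⊩-up (transpose-⇨ (maximum _)) ⊩-⊤
    ; meet = λ h h′ → ⊩-up (⇨-distribˡ-∧-≥ x _ _) (⊩-∧ h h′)
    }

  -- A filter avoiding an up-directed family extends to a maximal one, which
  -- is meet irreducible: if it were G ∩ K, both G and K would meet the
  -- family, and an upper bound of the two common elements would lie in G ∩ K.
  module Separation (F : ImpFilter) {W : Set i} (ι : W → Carrier) (w₀ : W)
    (directed : ∀ w w′ → Σ W λ u → ι w ≤ ι u × ι w′ ≤ ι u)
    (meets : ∀ w → MeetOfA (ι w)) (avoids : ∀ w → ¬ F ⊩ ι w) where

    Extension : Set _
    Extension = Σ ImpFilter λ G → F ⊆F G × ∀ w → ¬ G ⊩ ι w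

    _⊑_ : Extension → Extension → Set _
    (G , _) ⊑ (K , _) = G ⊆F K

    module _ (C : Extension → Set) (chain : Chain _⊑_ C) where

      -- The summand for `F` provides an upper bound for the empty chain too.
      ⋃ : Carrier → Set _
      ⋃ x = F ⊩ x ⊎ Σ Extension λ E → C E × proj₁ E ⊩ x

      ⋃-isFilter : HFilter ⋃
      ⋃-isFilter = record
        { up   = λ { le (inj₁ h) → inj₁ (⊩-up le h)
                   ; le (inj₂ (E , E∈C , h)) → inj₂ (E , E∈C , ⊩-up le h) }
        ; top  = inj₁ ⊩-⊤
        ; meet = meet
        }
        where
        meet : ∀ {x y} → ⋃ x → ⋃ y → ⋃ (x ∧ y)
        meet (inj₁ h) (inj₁ h′) = inj₁ (⊩-∧ h h′)
        meet (inj₁ h) (inj₂ (E , E∈C , h′)) =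
          inj₂ (E , E∈C , ⊩-∧ (⊩-mono {F} {proj₁ E} (proj₁ (proj₂ E)) h) h′)
        meet (inj₂ (E , E∈C , h)) (inj₁ h′) =
          inj₂ (E , E∈C , ⊩-∧ h (⊩-mono {F} {proj₁ E} (proj₁ (proj₂ E)) h′))
        meet (inj₂ (E , E∈C , h)) (inj₂ (E′ , E′∈C , h′)) with chain E E′ E∈C E′∈C
        ... | inj₁ E⊑E′ = inj₂ (E′ , E′∈C , ⊩-∧ (⊩-mono {proj₁ E} {proj₁ E′} E⊑E′ h) h′)
        ... | inj₂ E′⊑E = inj₂ (E , E∈C , ⊩-∧ h (⊩-mono {proj₁ E′} {proj₁ E} E′⊑E h′))

      upper-bound : Σ Extension λ U → ∀ E → C E → E ⊑ U
      upper-bound = (trace ⋃-isFilter , (λ e e∈F → mem-trace⁺ ⋃-isFilter e (inj₁ (mem⇒⊩ e∈F))) , avoid) ,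
        λ E E∈C e e∈E → mem-trace⁺ ⋃-isFilter e (inj₂ (E , E∈C , mem⇒⊩ e∈E))
        where
        avoid : ∀ w → ¬ trace ⋃-isFilter ⊩ ι w
        avoid w h with ⊩-trace⁻ ⋃-isFilter h
        ... | inj₁ h′ = avoids w h′
        ... | inj₂ (E , _ , h′) = proj₂ (proj₂ E) w h′

    separation : Σ A* λ r → F ⊆F proj₁ r × ∀ w → ¬ proj₁ r ⊩ ι w
    separation = (M , proper , irreducible) , F⊆M , M-avoids
      where
      maximal : Σ Extension λ E → ∀ E′ → E ⊑ E′ → E′ ⊑ E
      maximal = zorn {s = 0ℓ} Extension _⊑_
        (record { isEquivalence = ≡-isEquivalence ; reflexive = λ { refl _ h → h }
                ; trans = λ G⊆K K⊆N e h → K⊆N e (G⊆K e h) })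
        upper-bound

      M : ImpFilter
      M = proj₁ (proj₁ maximal)

      F⊆M : F ⊆F M
      F⊆M = proj₁ (proj₂ (proj₁ maximal))

      M-avoids : ∀ w → ¬ M ⊩ ι w
      M-avoids = proj₂ (proj₂ (proj₁ maximal))

      -- Nonemptiness of the family enters here: a filter containing all of `A` would force the
      -- value at `w₀`.
      proper : Proper M
      proper all = let es , x≈ = meets w₀ in
        M-avoids w₀ (via (All.universal all es) (reflexive (Eq.sym x≈)))

      hits : ∀ G → M ⊆F G → ¬ G ≐F M → Σ W λ w → G ⊩ ι w
      hits G M⊆G G≠M = dne λ none → G≠M
        (proj₂ maximal (G , (λ e → M⊆G e ∘ F⊆M e) , λ w h → none (w , h)) M⊆G , M⊆G)

      irreducible : ¬ (Σ ImpFilter λ G → Σ ImpFilter λ K → ¬ (G ≐F M) × ¬ (K ≐F M) × IsMeet M G K)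
      irreducible (G , K , G≠M , K≠M , M=G∩K) =
        let w , Gw = hits G (λ e → proj₁ ∘ proj₁ (M=G∩K e)) G≠M
            w′ , Kw = hits K (λ e → proj₂ ∘ proj₁ (M=G∩K e)) K≠M
            u , w≤u , w′≤u = directed w w′
            e , e∉M , u≤e = ⊮⇒∉ {M} (meets u) (M-avoids u)
        in e∉M (proj₂ (M=G∩K e) (⊩⇒mem (⊩-up (≤-trans w≤u u≤e) Gw) , ⊩⇒mem (⊩-up (≤-trans w′≤u u≤e) Kw)))

  -- Bounds and primeness for meet irreducible filters.

  module _ (r : A*) where

    private
      R : ImpFilter
      R = proj₁ r

    missing : Σ (El H A) λ e → ¬ mem R e
    missing = dne λ none → proj₁ (proj₂ r) λ e → dne λ e∉R → none (e , e∉R)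

    -- R is strictly below its residuals at d and at e, hence, being meet
    -- irreducible, strictly below their intersection.
    common-bound : ∀ {d e} → ¬ mem R d → ¬ mem R e →
      Σ (El H A) λ y → ¬ mem R y × R ⊩ proj₁ d ⇨ proj₁ y × R ⊩ proj₁ e ⇨ proj₁ y
    common-bound {d} {e} d∉R e∉R = dne λ none → proj₂ (proj₂ r)
      ( residual d , residual e , strict d d∉R , strict e e∉R
      , λ y → (λ y∈R → below d y∈R , below e y∈R)
            , λ (dy , ey) → dne λ y∉R → none
                (y , y∉R , mem-trace⁻ (residual-isFilter R _) y dy , mem-trace⁻ (residual-isFilter R _) y ey))
      where
      residual : El H A → ImpFilter
      residual d = trace (residual-isFilter R (proj₁ d))

      below : ∀ d {y} → mem R y → mem (residual d) y
      below d {y} y∈R = mem-trace⁺ (residual-isFilter R (proj₁ d)) y (⊩-up y≤x⇨y (mem⇒⊩ y∈R))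

      strict : ∀ d → ¬ mem R d → ¬ (residual d ≐F R)
      strict d d∉R (res⊆R , _) =
        d∉R (res⊆R d (mem-trace⁺ (residual-isFilter R _) d (⊩-up (reflexive (Eq.sym ⇨-unit)) ⊩-⊤)))

    -- Each value is replaced by a factor outside `R`, and `common-bound` is iterated, composing
    -- implications to carry earlier bounds along. The result will interpret the variable y of `𝔸`.
    common-bounds : ∀ {B : Set b} (f : B → Carrier) {xs} → All (λ x → MeetOfA (f x) × ¬ R ⊩ f x) xs →
      Σ (El H A) λ y → ¬ mem R y × All (λ x → R ⊩ f x ⇨ proj₁ y) xs
    common-bounds f [] = let y , y∉R = missing in y , y∉R , []
    common-bounds f ((fx , R⊮fx) ∷ hs) =
      let y , y∉R , bound = common-bounds f hs
          e , e∉R , fx≤e = ⊮⇒∉ {R} fx R⊮fx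
          z , z∉R , ez , yz = common-bound e∉R y∉R
      in z , z∉R , ⊩-up (⇨-relax fx≤e ≤-rfl) ez ∷
           All.map (λ xy → ⊩-up (transpose-⇨ (≤-trans (∧-greatest (≤-trans (x∧y≤x _ _) (x∧y≤y _ _))
             (≤-trans (∧-monotonic (x∧y≤x _ _) ≤-rfl) ⇨-eval)) ⇨-eval)) (⊩-∧ xy yz)) bound

    -- Otherwise a common bound of `x` and `y` outside `R` would be detached from `x ∨ y`.
    ∨-prime : ∀ {x y} → MeetOfA x → MeetOfA y → ¬ R ⊩ x → ¬ R ⊩ y → ¬ R ⊩ x ∨ y
    ∨-prime mx my R⊮x R⊮y R⊩x∨y =
      let z , z∉R , bounds = common-bounds id ((mx , R⊮x) ∷ (my , R⊮y) ∷ [])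
      in z∉R (⊩⇒mem (⊩-mp (⊩-up (⇨-distribˡ-∨-∧-≥ _ _ _)
           (⊩-∧ (All.head bounds) (All.head (All.tail bounds)))) R⊩x∨y))

    ⊮⊥ : ¬ R ⊩ ⊥
    ⊮⊥ h = proj₁ (proj₂ r) λ e → ⊩⇒mem (⊩-up (minimum _) h)

    -- Meet irreducible filters are prime for finite intersections: with y from
    -- common-bound, (d → y) → (e → y) → y lies above d and e but not in R.
    outside-∩ : ∀ {s} (S : A* → Set s) Q → All (λ q → S q → ¬ q ≤* r) Q →
      Σ (El H A) λ z → ¬ mem R z × All (λ q → S q → mem (proj₁ q) z) Q
    outside-∩ S [] [] = let z , z∉R = missing in z , z∉R , []
    outside-∩ S (q ∷ Q) (q≰r ∷ Q≰r) = extend (outside-∩ S Q Q≰r) em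
      where
      extend : (Σ (El H A) λ z → ¬ mem R z × All (λ q → S q → mem (proj₁ q) z) Q) → Dec (S q) →
        Σ (El H A) λ z → ¬ mem R z × All (λ q → S q → mem (proj₁ q) z) (q ∷ Q)
      extend (z , z∉R , z∈Q) (no ¬Sq) = z , z∉R , (λ Sq → contradiction Sq ¬Sq) ∷ z∈Q
      extend (z , z∉R , z∈Q) (yes Sq) =
        let d , d∈q , d∉R = dne λ none → q≰r Sq λ d d∈q → dne λ d∉R → none (d , d∈q , d∉R)
            y , y∉R , dy , zy = common-bound d∉R z∉R
            t = (d ⇒ₐ y) ⇒ₐ ((z ⇒ₐ y) ⇒ₐ y)
        in t ,
           (λ h → y∉R (⊩⇒mem (⊩-mp (⊩-mp (mem⇒⊩ h) dy) zy))) ,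
           (λ _ → mem-up {proj₁ q} d t (transpose-⇨ (transpose-⇨
             (≤-trans (x∧y≤x _ _) (⇨-applyʳ ≤-rfl)))) d∈q) ∷
           All.map (λ {q′} z∈q′ Sq′ → mem-up {proj₁ q′} z t (transpose-⇨ (transpose-⇨
             (≤-trans (∧-monotonic (x∧y≤x _ _) ≤-rfl) (⇨-applyʳ ≤-rfl)))) (z∈q′ Sq′)) z∈Q

  -- Values of translated formulas inside `A`.

  ⋀-A : ∀ {B : Set b} (f : B → Carrier) {xs} → All (λ x → A (f x)) xs → MeetOfA (⋀ f xs)
  ⋀-A f []              = [] , Eq.refl
  ⋀-A f {x ∷ _} (h ∷ hs) = let es , eq = ⋀-A f hs in (f x , h) ∷ es , ∧-cong Eq.refl eq

  All-upto : ∀ {p} {P : Fm TV → Set p} (g : ℕ → Fm TV) k → (∀ n → P (g n)) → All P (upto k g)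
  All-upto g zero    h = []
  All-upto g (suc k) h = ++⁺ (All-upto g k h) (h (suc k) ∷ [])

  -- 0 is the negation of 1, and 1 is `x ⇨ x` for any `x` in `A`.
  ⊥∈A : T (has¬ L) → A ⊥
  ⊥∈A ¬∈ = IsSubreduct.resp sub
    (antisym (≤-trans (∧-greatest ≤-rfl (≤-trans (maximum _) (reflexive (Eq.sym ⇨-unit)))) ⇨-eval) (minimum _))
    (cl¬ ¬∈ (cl⇒ (proj₂ nonempty) (proj₂ nonempty)))

  module _ (v : TV → El H A) where

    eval : Fm TV → Carrier
    eval = evalH H (proj₁ ∘ v)

    ⇛∈A : ∀ {Γ φ} → All (A ∘ eval) Γ → A (eval φ) → A (eval (Γ ⇛ φ))
    ⇛∈A []       hφ = hφ
    ⇛∈A (h ∷ hs) hφ = cl⇒ h (⇛∈A hs hφ)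

    -- The translation removes conjunctions and writes `𝟙` with implication alone. The remaining
    -- connectives come from `φ`, except the `𝟘` introduced by a negation, which `⊥∈A` covers.
    bold∈A : ∀ k φ → InL L φ → All (A ∘ eval) (bold k φ)
    bold∈A k (var j) _ = All-upto x[ j ,_] k λ n → proj₂ (v (just (j , n)))
    bold∈A k (φ ∧̇ ψ) (_ , lφ , lψ) = ++⁺ (bold∈A k φ lφ) (bold∈A k ψ lψ)
    bold∈A k (φ ∨̇ ψ) (∨∈ , lφ , lψ) = concat⁺ (map⁺ (All.map
      (λ {γ} hγ → map⁺ {f = γ ∨̇_} (All.map (cl∨ ∨∈ hγ) (bold∈A k ψ lψ))) (bold∈A k φ lφ)))
    bold∈A k (φ ⇒ ψ) (lφ , lψ) =
      map⁺ (All.map (λ {χ} → ⇛∈A {φ = χ} (bold∈A k φ lφ)) (bold∈A k ψ lψ))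
    bold∈A k (¬̇ φ) (¬∈ , lφ) = ⇛∈A {φ = 𝟘} (bold∈A k φ lφ) (⊥∈A ¬∈) ∷ []
    bold∈A k 𝟘 0∈ = proj₂ (v _) ∷ cl⇒ (proj₂ (v _)) (cl0 0∈) ∷ []
    bold∈A k 𝟙 _  = cl⇒ (proj₂ (v _)) (proj₂ (v _)) ∷ []

  open UpSem A* _≤*_
  open UpMeets em {X = A*} _≤*_ (λ _ h → h) (λ p≤q q≤s e h → q≤s e (p≤q e h))

  -- The minimal valuation and its algebraic approximations.

  module MinimalValuation (ρ : ℕ → Upset) (Q : List A*) where

    ρ₀ : ℕ → Upset
    ρ₀ j = (λ r → Σ A* λ q → q ∈ Q × proj₁ (ρ j) q × q ≤* r) ,
           λ r≤s (q , q∈Q , ρq , q≤r) → q , q∈Q , ρq , λ e h → r≤s e (q≤r e h)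

    ρ₀⊆ρ : ∀ j {r} → proj₁ (ρ₀ j) r → proj₁ (ρ j) r
    ρ₀⊆ρ j (q , _ , ρq , q≤r) = proj₂ (ρ j) q≤r ρq

    -- A valuation of x_{j+1} by the meet of the elements interpreting
    -- x_{j+1}^1, …, x_{j+1}^{size+1}, which lies above ρ₀.
    record Approximation : Set (lsuc (c ⊔ ℓ₁ ⊔ a)) where
      field
        size  : ℕ
        point : TV → El H A
        above : ∀ j n → All (λ q → proj₁ (ρ j) q → mem (proj₁ q) (point (just (j , n)))) Q

    open Approximation

    value : Approximation → ℕ → Carrier
    value w j = ⋀ (eval (point w)) (bold (suc (size w)) (var j))

    _⟨_⟩ : Fm ℕ → Approximation → Carrier
    φ ⟨ w ⟩ = evalH H (value w) φ

    _≼_ : Approximation → Approximation → Set ℓ₂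
    w ≼ w′ = ∀ j → value w j ≤ value w′ j

    ≼-refl : ∀ w → w ≼ w
    ≼-refl w j = ≤-rfl

    ⟨⟩-meet : ∀ φ → InL L φ → ∀ w → MeetOfA (φ ⟨ w ⟩)
    ⟨⟩-meet φ lφ w =
      let es , eq = ⋀-A (eval (point w)) (bold∈A (point w) (suc (size w)) φ lφ)
      in es , Eq.trans (Eq.sym (⋀-bold (proj₁ ∘ point w) (suc (size w)) (λ _ → Eq.refl) φ)) eq

    value∈ : ∀ w j {q} → q ∈ Q → proj₁ (ρ j) q → proj₁ q ⊩ value w j
    value∈ w j q∈Q ρq = ⊩-⋀ (eval (point w)) (All-upto x[ j ,_] (suc (size w))
      λ n → mem⇒⊩ (All.lookup (above w j n) q∈Q ρq))

    -- Only variable `j` is constrained; every other variable takes the value 1 = `z ⇨ z`, which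
    -- lies in all filters.
    single : ∀ j z → All (λ q → proj₁ (ρ j) q → mem (proj₁ q) z) Q → Approximation
    single j z z∈Q = record
      { size = 0 ; point = λ { nothing → z ; (just (j′ , _)) → at j′ (j ≟ j′) }
      ; above = λ j′ _ → at∈ j′ (j ≟ j′) }
      where
      at : ∀ j′ → Dec (j ≡ j′) → El H A
      at j′ (yes _) = z
      at j′ (no _)  = z ⇒ₐ z

      at∈ : ∀ j′ d → All (λ q → proj₁ (ρ j′) q → mem (proj₁ q) (at j′ d)) Q
      at∈ j′ (yes refl) = z∈Q
      at∈ j′ (no _)     = All.universal (λ q _ → one (proj₁ q) z) Q

    single-value : ∀ j z z∈Q → value (single j z z∈Q) j ≤ proj₁ z
    single-value j z z∈Q with j ≟ j
    ... | yes refl = x∧y≤x _ _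
    ... | no j≢j   = contradiction refl j≢j

    trivial : Approximation
    trivial = record
      { size = 0 ; point = λ _ → nonempty ⇒ₐ nonempty
      ; above = λ _ _ → All.universal (λ q _ → one (proj₁ q) nonempty) Q }

    -- The copies of `w` and `w′` are concatenated, so that each variable receives at most the meet
    -- of its two values.
    directed : ∀ w w′ → Σ Approximation λ u → u ≼ w × u ≼ w′
    directed w w′ = u , lower-left , lower-right
      where
      m = suc (size w)

      merge : ℕ → ∀ i → Dec (i ≤ⁿ m) → El H A
      merge j i (yes _) = point w (just (j , i))
      merge j i (no _)  = point w′ (just (j , i ∸ m))

      merge∈ : ∀ j i d → All (λ q → proj₁ (ρ j) q → mem (proj₁ q) (merge j i d)) Q
      merge∈ j i (yes _) = above w j i
      merge∈ j i (no _)  = above w′ j (i ∸ m)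

      u : Approximation
      u = record
        -- Since `m` is already a successor, the number of copies `suc (size w′ + m)` is exactly the
        -- sum of the two numbers of copies.
        { size = size w′ + m
        ; point = λ { nothing → point w nothing ; (just (j , i)) → merge j i (i ≤? m) }
        ; above = λ j i → merge∈ j i (i ≤? m) }

      merge-low : ∀ j i → i ≤ⁿ m → ∀ d → proj₁ (merge j i d) ≤ proj₁ (point w (just (j , i)))
      merge-low j i i≤m (yes _)  = ≤-rfl
      merge-low j i i≤m (no i≰m) = contradiction i≤m i≰m

      merge-high : ∀ j i d → proj₁ (merge j (suc i + m) d) ≤ proj₁ (point w′ (just (j , suc i)))
      merge-high j i (yes i≤m) = contradiction (≤ⁿ-trans (s≤s (m≤n+m m i)) i≤m) 1+n≰n
      merge-high j i (no _) rewrite m+n∸n≡m (suc i) m = ≤-rfl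

      lower-left : u ≼ w
      lower-left j = ≤-trans (⋀-upto-≤ˡ (eval (point u)) x[ j ,_] m (suc (size w′)))
        (⋀-upto-mono (eval (point u)) (eval (point w)) x[ j ,_] x[ j ,_] m
          λ i i≤m → merge-low j (suc i) i≤m (suc i ≤? m))

      lower-right : u ≼ w′
      lower-right j = ≤-trans (⋀-upto-≤ʳ (eval (point u)) x[ j ,_] m (suc (size w′)))
        (⋀-upto-mono (eval (point u)) (eval (point w′)) (λ i → x[ j , i + m ]) x[ j ,_] (suc (size w′))
          λ i _ → merge-high j i (suc i + m ≤? m))

    -- Truth at all sufficiently small approximations; down-directedness of `≼` makes it stable
    -- under finite conjunction.
    Eventually : (Approximation → Set ℓ) → Set _
    Eventually P = Σ Approximation λ w → ∀ w′ → w′ ≼ w → P w′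

    module _ {P : Approximation → Set ℓ} where

      always : (∀ w → P w) → Eventually P
      always h = trivial , λ w′ _ → h w′

      ev-map : ∀ {ℓ′} {P′ : Approximation → Set ℓ′} → (∀ w → P w → P′ w) → Eventually P → Eventually P′
      ev-map f (w , h) = w , λ w′ le → f w′ (h w′ le)

      ev-zip : ∀ {ℓ′ ℓ″} {P′ : Approximation → Set ℓ′} {P″ : Approximation → Set ℓ″} →
        (∀ w → P w → P′ w → P″ w) → Eventually P → Eventually P′ → Eventually P″
      ev-zip f (w , h) (w′ , h′) = let u , u≼w , u≼w′ = directed w w′ in
        u , λ t t≼u → f t (h t λ j → ≤-trans (t≼u j) (u≼w j)) (h′ t λ j → ≤-trans (t≼u j) (u≼w′ j))

    -- Esakia's lemma: the filter generated by R and all X w avoids all Y w.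
    compactness : (X Y : Approximation → Carrier) →
      (∀ {w w′} → w ≼ w′ → X w ≤ X w′) → (∀ {w w′} → w ≼ w′ → Y w′ ≤ Y w) →
      (∀ w → MeetOfA (X w)) → (∀ w → MeetOfA (Y w)) →
      ∀ R → (∀ w → ¬ R ⊩ X w ⇨ Y w) →
      Σ A* λ s → R ⊆F proj₁ s × (∀ w → proj₁ s ⊩ X w) × (∀ w → ¬ proj₁ s ⊩ Y w)
    compactness X Y X-mono Y-anti X-meet Y-meet R R⊮ =
      let s , G⊆s , s⊮ = Separation.separation G Y trivial
            (λ w w′ → let u , u≼w , u≼w′ = directed w w′ in u , Y-anti u≼w , Y-anti u≼w′)
            Y-meet G⊮Y
      in s , (λ e e∈R → G⊆s e (mem-trace⁺ isF e (trivial , ⊩-up y≤x⇨y (mem⇒⊩ e∈R)))) ,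
         (λ w → ⊩-mono G⊆s (⊩-trace⁺ isF (X-meet w) (w , ⊩-up (reflexive (Eq.sym ⇨-unit)) ⊩-⊤))) , s⊮
      where
      generated : Carrier → Set _
      generated x = Σ Approximation λ w → R ⊩ X w ⇨ x

      isF : HFilter generated
      isF = record
        { up   = λ le (w , h) → w , ⊩-up (⇨ʳ-covariant le) h
        ; top  = trivial , ⊩-up (transpose-⇨ (maximum _)) ⊩-⊤
        ; meet = λ (w , h) (w′ , h′) → let u , u≼w , u≼w′ = directed w w′ in
            u , ⊩-up (⇨-distribˡ-∧-≥ _ _ _)
                  (⊩-∧ (⊩-up (⇨-relax (X-mono u≼w) ≤-rfl) h) (⊩-up (⇨-relax (X-mono u≼w′) ≤-rfl) h′))
        }

      G : ImpFilter
      G = trace isF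

      G⊮Y : ∀ w → ¬ G ⊩ Y w
      G⊮Y w h = let w′ , h′ = ⊩-trace⁻ isF h
                    u , u≼w , u≼w′ = directed w w′
                in R⊮ u (⊩-up (⇨-relax (X-mono u≼w′) (Y-anti u≼w)) h′)

    -- Positive failure and negative truth along the approximations.

    mutual
      -- A variable fails at `r` when `r` is above none of the finitely many generators of its
      -- upset, and `outside-∩` turns this into an element of `A`. A failing implication supplies
      -- one point above `r` at which the induction applies.
      pos-refuted : ∀ φ → Pos φ → InL L φ → ∀ {r} → ¬ ⟦ φ ⟧ ρ₀ r →
        Eventually λ w → ¬ proj₁ r ⊩ φ ⟨ w ⟩
      pos-refuted (var j) _ _ {r} ¬h =
        let z , z∉r , z∈Q = outside-∩ r (proj₁ (ρ j)) Q
              (All.tabulate λ {q} q∈Q ρq q≤r → ¬h (q , q∈Q , ρq , q≤r))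
        in single j z z∈Q , λ w le h →
             z∉r (⊩⇒mem (⊩-up (≤-trans (le j) (single-value j z z∈Q)) h))
      pos-refuted (φ ∧̇ ψ) (p , q) (_ , lφ , lψ) {r} ¬h with em {P = ⟦ φ ⟧ ρ₀ r}
      ... | yes φr = ev-map (λ w ¬ψ → ¬ψ ∘ ⊩-up (x∧y≤y _ _)) (pos-refuted ψ q lψ (λ ψr → ¬h (φr , ψr)))
      ... | no ¬φr = ev-map (λ w ¬φ → ¬φ ∘ ⊩-up (x∧y≤x _ _)) (pos-refuted φ p lφ ¬φr)
      pos-refuted (φ ∨̇ ψ) (p , q) (_ , lφ , lψ) {r} ¬h =
        ev-zip (λ w → ∨-prime r (⟨⟩-meet φ lφ w) (⟨⟩-meet ψ lψ w))
          (pos-refuted φ p lφ (¬h ∘ inj₁)) (pos-refuted ψ q lψ (¬h ∘ inj₂))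
      pos-refuted (φ ⇒ ψ) (p , q) (lφ , lψ) ¬h =
        let s , r≤s , φs , ¬ψs = dne ¬h in
        ev-zip (λ w φ⊩ ψ⊮ h → ψ⊮ (⊩-mp (⊩-mono r≤s h) φ⊩))
          (neg-forced φ p lφ φs) (pos-refuted ψ q lψ ¬ψs)
      pos-refuted (¬̇ φ) p (_ , lφ) ¬h =
        let s , r≤s , φs = dne ¬h in
        ev-map (λ w φ⊩ h → ⊮⊥ s (⊩-mp (⊩-mono r≤s h) φ⊩)) (neg-forced φ p lφ φs)
      pos-refuted 𝟘 _ _ {r} _ = always λ _ → ⊮⊥ r
      pos-refuted 𝟙 _ _ ¬h = contradiction (lift tt) ¬h

      neg-forced : ∀ φ → Neg φ → InL L φ → ∀ {r} → ⟦ φ ⟧ ρ₀ r →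
        Eventually λ w → proj₁ r ⊩ φ ⟨ w ⟩
      neg-forced (φ ∧̇ ψ) (p , q) (_ , lφ , lψ) (φr , ψr) =
        ev-zip (λ _ → ⊩-∧) (neg-forced φ p lφ φr) (neg-forced ψ q lψ ψr)
      neg-forced (φ ∨̇ ψ) (p , q) (_ , lφ , lψ) (inj₁ φr) =
        ev-map (λ _ → ⊩-up (x≤x∨y _ _)) (neg-forced φ p lφ φr)
      neg-forced (φ ∨̇ ψ) (p , q) (_ , lφ , lψ) (inj₂ ψr) =
        ev-map (λ _ → ⊩-up (y≤x∨y _ _)) (neg-forced ψ q lψ ψr)
      neg-forced (φ ⇒ ψ) (p , q) (lφ , lψ) {r} h = neg-implication φ p lφ (ψ ⟨_⟩)
        (λ le → evalH-antitone le ψ q) (⟨⟩-meet ψ lψ) r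
        λ s r≤s φs s⊮ψ → h (s , r≤s , φs , λ ψs → let w , f = neg-forced ψ q lψ ψs in s⊮ψ w (f w (≼-refl w)))
      -- Negation is treated as an implication with constant consequent `⊥`, which belongs to `A` in
      -- this case.
      neg-forced (¬̇ φ) p (¬∈ , lφ) {r} h = neg-implication φ p lφ (λ _ → ⊥)
        (λ _ → ≤-rfl) (λ _ → (⊥ , ⊥∈A ¬∈) ∷ [] , antisym (minimum _) (x∧y≤x _ _)) r
        λ s r≤s φs _ → h (s , r≤s , φs)
      neg-forced 𝟙 _ _ _ = always λ _ → ⊩-⊤

      -- If no approximation forces the implication, `compactness` yields a point above `r` forcing
      -- `φ` at every `w` and `Y` at none. By contraposition of `pos-refuted`, `φ` holds there,
      -- against the hypothesis. The family `Y` covers implication and negation at once.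
      neg-implication : ∀ φ → Pos φ → InL L φ → (Y : Approximation → Carrier) →
        (∀ {w w′} → w ≼ w′ → Y w′ ≤ Y w) → (∀ w → MeetOfA (Y w)) → ∀ r →
        (∀ s → r ≤* s → ⟦ φ ⟧ ρ₀ s → ¬ (∀ w → ¬ proj₁ s ⊩ Y w)) →
        Eventually λ w → proj₁ r ⊩ φ ⟨ w ⟩ ⇨ Y w
      neg-implication φ p lφ Y Y-anti Y-meet r h with em {P = Σ Approximation λ w → proj₁ r ⊩ φ ⟨ w ⟩ ⇨ Y w}
      ... | yes (w , r⊩) = w , λ w′ le → ⊩-up (⇨-relax (evalH-monotone le φ p) (Y-anti le)) r⊩
      ... | no none =
        let s , r≤s , s⊩φ , s⊮Y = compactness (φ ⟨_⟩) Y (λ le → evalH-monotone le φ p) Y-anti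
              (⟨⟩-meet φ lφ) Y-meet (proj₁ r) (λ w r⊩ → none (w , r⊩))
        in contradiction s⊮Y (h s r≤s (dne λ ¬φs →
             let w , f = pos-refuted φ p lφ ¬φs in f w (≼-refl w) (s⊩φ w)))

    -- Approximations lie above `ρ` at the points of `Q`, which settles variables; negative formulas
    -- true under `ρ` stay true under the smaller `ρ₀`.
    antecedent-forced : ∀ {φ} → SAnt φ → InL L φ → ∀ {q} → q ∈ Q → ⟦ φ ⟧ ρ q →
      Eventually λ w → proj₁ q ⊩ φ ⟨ w ⟩
    antecedent-forced (sa-var j) _ q∈Q ρq = always λ w → value∈ w j q∈Q ρq
    antecedent-forced {φ} (sa-neg n) lφ q∈Q φq = neg-forced φ n lφ (⟦⟧-antitone ρ₀⊆ρ φ n φq)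
    antecedent-forced sa-1 _ _ _ = always λ _ → ⊩-⊤
    antecedent-forced (sa-∧ s t) (_ , lφ , lψ) q∈Q (φq , ψq) =
      ev-zip (λ _ → ⊩-∧) (antecedent-forced s lφ q∈Q φq) (antecedent-forced t lψ q∈Q ψq)
    antecedent-forced (sa-∨ s t) (_ , lφ , lψ) q∈Q (inj₁ φq) =
      ev-map (λ _ → ⊩-up (x≤x∨y _ _)) (antecedent-forced s lφ q∈Q φq)
    antecedent-forced (sa-∨ s t) (_ , lφ , lψ) q∈Q (inj₂ ψq) =
      ev-map (λ _ → ⊩-up (y≤x∨y _ _)) (antecedent-forced t lψ q∈Q ψq)

    positive-refuted : ∀ φ → Pos φ → InL L φ → ∀ r → ¬ ⟦ φ ⟧ ρ r →
      Eventually λ w → ¬ proj₁ r ⊩ φ ⟨ w ⟩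
    positive-refuted φ p lφ r ¬φr = pos-refuted φ p lφ (¬φr ∘ ⟦⟧-monotone ρ₀⊆ρ φ p)

  -- Refuting Sahlqvist formulas and transferring validity.

  module _ (ρ : ℕ → Upset) (p : A*) where

    open MinimalValuation ρ

    -- Approximations depend on `Q`; allowing every `Q` that includes `Q₀` lets the witnesses of
    -- several formulas be pooled.
    EventuallyRefuted : Fm ℕ → Set _
    EventuallyRefuted φ = Σ (List A*) λ Q₀ → ∀ Q → (∀ {q} → q ∈ Q₀ → q ∈ Q) →
      Eventually Q λ w → ¬ proj₁ p ⊩ evalH H (value Q w) φ

    implication-refuted : ∀ {φ} → SImp φ → InL L φ → ¬ ⟦ φ ⟧ ρ p → EventuallyRefuted φ
    implication-refuted {φ} (si-pos pos) lφ ¬φp = [] , λ Q _ → positive-refuted Q φ pos lφ p ¬φp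
    implication-refuted (si-¬ s) (_ , lφ) ¬h =
      let q , p≤q , φq = dne ¬h in q ∷ [] , λ Q ⊆Q →
      ev-map Q (λ w φ⊩ h → ⊮⊥ q (⊩-mp (⊩-mono p≤q h) φ⊩)) (antecedent-forced Q s lφ (⊆Q (here refl)) φq)
    implication-refuted (si-⇒ {φ} {ψ} s pos) (lφ , lψ) ¬h =
      let q , p≤q , φq , ¬ψq = dne ¬h in q ∷ [] , λ Q ⊆Q →
      ev-zip Q (λ w φ⊩ ψ⊮ h → ψ⊮ (⊩-mp (⊩-mono p≤q h) φ⊩))
        (antecedent-forced Q s lφ (⊆Q (here refl)) φq) (positive-refuted Q ψ pos lψ q ¬ψq)

    body-refuted : ∀ {φ} → SBody φ → InL L φ → ¬ ⟦ φ ⟧ ρ p → EventuallyRefuted φ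
    body-refuted (sb-imp s) lφ ¬h = implication-refuted s lφ ¬h
    body-refuted (sb-∧ {φ} s t) (_ , lφ , lψ) ¬h with em {P = ⟦ φ ⟧ ρ p}
    ... | yes φp = let Q₀ , f = body-refuted t lψ (λ ψp → ¬h (φp , ψp)) in
      Q₀ , λ Q ⊆Q → ev-map Q (λ w ψ⊮ → ψ⊮ ∘ ⊩-up (x∧y≤y _ _)) (f Q ⊆Q)
    ... | no ¬φp = let Q₀ , f = body-refuted s lφ ¬φp in
      Q₀ , λ Q ⊆Q → ev-map Q (λ w φ⊮ → φ⊮ ∘ ⊩-up (x∧y≤x _ _)) (f Q ⊆Q)
    body-refuted (sb-∨ {φ} {ψ} s t) (_ , lφ , lψ) ¬h =
      let Q₀ , f = body-refuted s lφ (¬h ∘ inj₁)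
          Q₁ , g = body-refuted t lψ (¬h ∘ inj₂)
      in Q₀ ++ Q₁ , λ Q ⊆Q → ev-zip Q
           (λ w → ∨-prime p (⟨⟩-meet Q φ lφ w) (⟨⟩-meet Q ψ lψ w))
           (f Q (⊆Q ∘ ∈-++⁺ˡ)) (g Q (⊆Q ∘ ∈-++⁺ʳ Q₀))

    bodies-refuted : ∀ {φs} → All SBody φs → All (InL L) φs → All (λ φ → ¬ ⟦ φ ⟧ ρ p) φs →
      Σ (List A*) λ Q₀ → ∀ Q → (∀ {q} → q ∈ Q₀ → q ∈ Q) →
      Eventually Q λ w → All (λ φ → MeetOfA (evalH H (value Q w) φ) × ¬ proj₁ p ⊩ evalH H (value Q w) φ) φs
    bodies-refuted [] [] [] = [] , λ Q _ → always Q λ _ → []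
    bodies-refuted {φ ∷ _} (s ∷ ss) (l ∷ ls) (h ∷ hs) =
      let Q₀ , f = body-refuted s l h
          Q₁ , g = bodies-refuted ss ls hs
      in Q₀ ++ Q₁ , λ Q ⊆Q → ev-zip Q (λ w φ⊮ rest → (⟨⟩-meet Q φ l w , φ⊮) ∷ rest)
           (f Q (⊆Q ∘ ∈-++⁺ˡ)) (g Q (⊆Q ∘ ∈-++⁺ʳ Q₀))

    -- Some `e` outside `p` bounds all the refuted values modulo `p`. Interpreting y as `e` and the
    -- copies by `w`, validity of `𝔸` in `A` would put `e` in `p`.
    not-all-refuted : ∀ Φ → All SBody (toList Φ) → All (InL L) (toList Φ) →
      (∀ k → ValidIn H A (𝔸 Φ (suc k))) → ¬ All (λ φ → ¬ ⟦ φ ⟧ ρ p) (toList Φ)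
    not-all-refuted Φ sahl lΦ valid refuted =
      e∉P (⊩⇒mem (⊩-mp (⊩-up (reflexive (Eq.trans (Eq.sym 𝔸≈⊤) (evalH-⇛ v Γ yv))) ⊩-⊤)
        (⊩-⋀ (evalH H v) (map⁺ (All.map
          (λ {φ} → ⊩-up (reflexive (Eq.sym (Eq.trans (evalH-⇛ v (bold k φ) yv)
            (⇨-cong (⋀-bold v k agree φ) Eq.refl))))) bounds)))))
      where
      Q : List A*
      Q = proj₁ (bodies-refuted sahl lΦ refuted)

      found : Eventually Q _
      found = proj₂ (bodies-refuted sahl lΦ refuted) Q id

      w : Approximation Q
      w = proj₁ found

      bounded : Σ (El H A) λ y → ¬ mem (proj₁ p) y × All (λ φ → proj₁ p ⊩ evalH H (value Q w) φ ⇨ proj₁ y) (toList Φ)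
      bounded = common-bounds p (evalH H (value Q w)) (proj₂ found w (≼-refl Q w))

      e = proj₁ bounded
      e∉P = proj₁ (proj₂ bounded)
      bounds = proj₂ (proj₂ bounded)

      k = suc (Approximation.size w)

      v : TV → Carrier
      v nothing  = proj₁ e
      v (just x) = proj₁ (Approximation.point w (just x))

      v∈A : ∀ x → A (v x)
      v∈A nothing  = proj₂ e
      v∈A (just x) = proj₂ (Approximation.point w (just x))

      Γ : List (Fm TV)
      Γ = map (λ φ → bold k φ ⇛ yv) (toList Φ)

      𝔸≈⊤ : evalH H v (𝔸 Φ k) ≈ ⊤
      𝔸≈⊤ = valid _ v v∈A

      -- The two valuations agree on copies but may differ at y, hence a comparison index by index.
      agree : ∀ j → ⋀ (evalH H v) (bold k (var j)) ≈ value Q w j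
      agree j = antisym (⋀-upto-mono _ _ x[ j ,_] x[ j ,_] k λ _ _ → ≤-rfl)
                        (⋀-upto-mono _ _ x[ j ,_] x[ j ,_] k λ _ _ → ≤-rfl)

  -- If y fails at `q`, then by `bold-sound` every `φ` fails there under `⋂ ρ (suc k)`. The member
  -- of `𝔸` then used in `A` is indexed by the approximation found, not by this `k`.
  Up-validates : ∀ Φ → All SBody (toList Φ) → All (InL L) (toList Φ) →
    (∀ k → ValidIn H A (𝔸 Φ (suc k))) → ∀ k → ValidUp (𝔸 Φ (suc k))
  Up-validates Φ sahl lΦ valid k ρ p = ⇛-intro ρ _ yv {p} λ {q} p≤q hyps →
    dne λ ¬yq → not-all-refuted (⋂ ρ (suc k)) q Φ sahl lΦ valid
      (All.map (λ {φ} φ⇛y φq → ¬yq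
        (⇛-elim ρ (bold (suc k) φ) yv {q} {q} φ⇛y (λ _ h → h) (bold-sound ρ (suc k) φ φq))) (map⁻ hyps))

theorem9p5 : (∀ {ℓ} → ExcludedMiddle ℓ) → (∀ {a r s} → Zorn a r s) →
    ∀ {c ℓ₁ ℓ₂ a : Level} (L : Lang) (Φ : SahlqvistQE L)
    (H : HeytingAlgebra c ℓ₁ ℓ₂) (A : HeytingAlgebra.Carrier H → Set a)
    (sub : IsSubreduct H L A) →
    (∀ k → ValidIn H A (𝔸 (φs Φ) (suc k))) →
    let open Filters H A (IsSubreduct.cl⇒ sub) in
    ∀ k → UpSem.ValidUp A* _≤*_ (𝔸 (φs Φ) (suc k))
theorem9p5 em zorn L Φ H A sub =
  FilterTheory.Up-validates em zorn L H A sub (φs Φ) (sahl Φ) (inL Φ)
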